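{- The equational theory of the time warp algebra $\mathbf{W}$ is decidable: there is an algorithm that, given any two terms $s,t$ in the signature $\langle \wedge,\vee,\cdot,{}',1\rangle$, decides whether $\mathbf{W}\models s\approx t$.
   Context: Let $\omega^+=\omega\cup\{\omega\}=\{0,1,2,\dots,\omega\}$ with its natural total order. A time warp is a map $f\colon\omega^+\to\omega^+$ preserving arbitrary joins; equivalently, $f$ is order-preserving, $f(0)=0$ and $f(\omega)=\sup\{f(n)\mid n\in\omega\}$. Let $W$ be the set of time warps and let $p$ be the predecessor time warp: $p(0)=0$, $p(\omega)=\omega$, $p(m)=m-1$ for $0<m<\omega$. The time warp algebra is $\mathbf{W}=\langle W,\wedge,\vee,\circ,{}',\mathrm{id}\rangle$, where $\wedge,\vee$ are pointwise minimum and maximum, $\circ$ is composition, $\mathrm{id}$ is the identity map, and $f'$ is the largest time warp $g$ with $f\circ g\le p$ pointwise (equivalently, the largest $g$ with $g\circ f\le p$). Terms are built from a countably infinite set of variables using binary $\wedge,\vee,\cdot$, unary ${}'$ and the constant $1$ (interpreted in $\mathbf{W}$ as $\wedge,\vee,\circ,{}',\mathrm{id}$). For terms $s,t$, $\mathbf{W}\models s\approx t$ means $h(s)=h(t)$ for every homomorphism $h$ from the term algebra to $\mathbf{W}$. -}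

module Defs where

open import Data.Nat using (ℕ; zero; suc; _≤_; _⊓_; _⊔_)
open import Data.Product using (_×_)
open import Relation.Binary.PropositionalEquality using (_≡_)

data ℕ∞ : Set where
  fin : ℕ → ℕ∞
  ω   : ℕ∞

data _≤∞_ : ℕ∞ → ℕ∞ → Set where
  fin≤fin : ∀ {m n} → m ≤ n → fin m ≤∞ fin n
  _≤ω     : ∀ x → x ≤∞ ω

_⊓∞_ : ℕ∞ → ℕ∞ → ℕ∞
fin m ⊓∞ fin n = fin (m ⊓ n)
fin m ⊓∞ ω     = fin m
ω     ⊓∞ y     = y

_⊔∞_ : ℕ∞ → ℕ∞ → ℕ∞
fin m ⊔∞ fin n = fin (m ⊔ n)
fin m ⊔∞ ω     = ω
ω     ⊔∞ y     = ω

IsLub : (ℕ → ℕ∞) → ℕ∞ → Set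
IsLub a u = (∀ n → a n ≤∞ u) × (∀ v → (∀ n → a n ≤∞ v) → u ≤∞ v)

record IsWarp (f : ℕ∞ → ℕ∞) : Set where
  field
    mono : ∀ x y → x ≤∞ y → f x ≤∞ f y
    zero-pres : f (fin zero) ≡ fin zero
    ω-sup : IsLub (λ n → f (fin n)) (f ω)

pred∞ : ℕ∞ → ℕ∞
pred∞ (fin zero)    = fin zero
pred∞ (fin (suc m)) = fin m
pred∞ ω             = ω

_≤ₚ_ : (ℕ∞ → ℕ∞) → (ℕ∞ → ℕ∞) → Set
f ≤ₚ g = ∀ x → f x ≤∞ g x

_∘∞_ : (ℕ∞ → ℕ∞) → (ℕ∞ → ℕ∞) → (ℕ∞ → ℕ∞)
(f ∘∞ g) x = f (g x)

IsResidual : (ℕ∞ → ℕ∞) → (ℕ∞ → ℕ∞) → Set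
IsResidual f g =
  IsWarp g × ((f ∘∞ g) ≤ₚ pred∞) ×
  (∀ h → IsWarp h → (f ∘∞ h) ≤ₚ pred∞ → h ≤ₚ g)

infixl 7 _·_
infixl 6 _∧_
infixl 5 _∨_
data Term : Set where
  var  : ℕ → Term
  _∧_  : Term → Term → Term
  _∨_  : Term → Term → Term
  _·_  : Term → Term → Term
  _′   : Term → Term
  one  : Term

-- evaluation of terms in W under an assignment σ (relational, since the
-- residual f' is specified by its universal property)
data _⊢_⇓_ (σ : ℕ → ℕ∞ → ℕ∞) : Term → (ℕ∞ → ℕ∞) → Set where
  ev-var : ∀ i → σ ⊢ var i ⇓ σ i
  ev-∧   : ∀ {s t f g} → σ ⊢ s ⇓ f → σ ⊢ t ⇓ g → σ ⊢ s ∧ t ⇓ (λ x → f x ⊓∞ g x)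
  ev-∨   : ∀ {s t f g} → σ ⊢ s ⇓ f → σ ⊢ t ⇓ g → σ ⊢ s ∨ t ⇓ (λ x → f x ⊔∞ g x)
  ev-·   : ∀ {s t f g} → σ ⊢ s ⇓ f → σ ⊢ t ⇓ g → σ ⊢ s · t ⇓ (f ∘∞ g)
  ev-′   : ∀ {s f g} → σ ⊢ s ⇓ f → IsResidual f g → σ ⊢ s ′ ⇓ g
  ev-1   : σ ⊢ one ⇓ (λ x → x)

⊨W_≈_ : Term → Term → Set
⊨W_≈_ s t =
  ∀ (σ : ℕ → ℕ∞ → ℕ∞) → (∀ i → IsWarp (σ i)) →
  ∀ f g → σ ⊢ s ⇓ f → σ ⊢ t ⇓ g → ∀ x → f x ≡ g x

{-# OPTIONS --safe #-}

-- An equation that fails in W already fails under one of finitely many assignments that can be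
-- listed from the terms.
--
-- Away from 0 the residual is f′(x) = sup {y < ω : f y < x}. Hence the value of a term u at a point v
-- depends on finitely many values of the variables, their number bounded in terms of u, except when
-- f′(ω) = ω, which says that f takes finite arguments to finite values; this property follows from the
-- analogous property of the variables and finitely many further values. Given a failure of s ≈ t, let V
-- be the set of all points involved. The map c n = #{m ∈ V : m < n} is monotone, reflects the order
-- below elements of V and sends m + 1 to c m + 1 for m ∈ V, so evaluation commutes with c when every
-- variable f is replaced by the warp generated by the pairs (c v, c (f v)) for v ∈ V, continued beyond
-- |V| by a constant or by the identity. These warps are bounded in size, and their residuals are
-- computable.
--
-- An arbitrary warp need not have a computable residual, and whether it maps finite to finite is not
-- decidable; but equality in ω⁺ is, so the transfer to a small counterexample can be carried out
-- under a double negation.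
module Submission where

open import Defs
open import Data.Empty using (⊥-elim)
open import Data.Fin using (Fin; toℕ; fromℕ<) renaming (zero to fzero; suc to fsuc)
open import Data.Fin.Properties using (any?; toℕ-fromℕ<)
open import Data.Maybe using (Maybe; just; nothing)
open import Data.Nat using (ℕ; zero; suc; pred; _+_; _≤_; _<_; _⊔_; z≤n; s≤s; _≤?_)
open import Data.Nat.Properties
open import Data.Product using (Σ; ∃; ∃-syntax; _×_; _,_; proj₁; proj₂)
open import Data.Sum as Sum using (_⊎_; inj₁; inj₂; [_,_])
open import Data.Vec using (Vec; []; _∷_; _++_; map; lookup; tabulate)
open import Data.Vec.Membership.Propositional using (_∈_)
open import Data.Vec.Membership.Propositional.Properties using (∈-map⁺)
open import Data.Vec.Properties using (lookup∘tabulate)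
open import Data.Vec.Relation.Unary.All as All using (All; []; _∷_)
open import Data.Vec.Relation.Unary.All.Properties using (++⁻; map⁺)
open import Data.Vec.Relation.Unary.Any using (here; there)
open import Function using (_∘_)
open import Relation.Binary.PropositionalEquality using (_≡_; _≢_; refl; sym; trans; cong; cong₂; subst; subst₂)
open import Relation.Nullary using (Dec; yes; no; ¬_)
open import Relation.Nullary.Decidable using (map′; decidable-stable; ¬¬-excluded-middle; ¬?; _×-dec_; _⊎-dec_)

-- The order and lattice operations of ω⁺.

fin-injective : ∀ {m n} → fin m ≡ fin n → m ≡ n
fin-injective refl = refl

infix 4 _≟∞_ _≤∞?_

_≟∞_ : (x y : ℕ∞) → Dec (x ≡ y)
fin m ≟∞ fin n = map′ (cong fin) fin-injective (m ≟ n)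
fin m ≟∞ ω     = no λ ()
ω     ≟∞ fin n = no λ ()
ω     ≟∞ ω     = yes refl

fin≤fin⁻¹ : ∀ {m n} → fin m ≤∞ fin n → m ≤ n
fin≤fin⁻¹ (fin≤fin p) = p

_≤∞?_ : (x y : ℕ∞) → Dec (x ≤∞ y)
x     ≤∞? ω     = yes (x ≤ω)
fin m ≤∞? fin n = map′ fin≤fin fin≤fin⁻¹ (m ≤? n)
ω     ≤∞? fin n = no λ ()

≤∞-refl : ∀ {x} → x ≤∞ x
≤∞-refl {fin n} = fin≤fin ≤-refl
≤∞-refl {ω}     = ω ≤ω

≤∞-reflexive : ∀ {x y} → x ≡ y → x ≤∞ y
≤∞-reflexive refl = ≤∞-refl

≤∞-trans : ∀ {x y z} → x ≤∞ y → y ≤∞ z → x ≤∞ z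
≤∞-trans (fin≤fin p) (fin≤fin q) = fin≤fin (≤-trans p q)
≤∞-trans {x} p       (_ ≤ω)      = x ≤ω

≤∞-antisym : ∀ {x y} → x ≤∞ y → y ≤∞ x → x ≡ y
≤∞-antisym (fin≤fin p) (fin≤fin q) = cong fin (≤-antisym p q)
≤∞-antisym (_ ≤ω)      (_ ≤ω)      = refl

0≤∞ : ∀ {x} → fin 0 ≤∞ x
0≤∞ {fin n} = fin≤fin z≤n
0≤∞ {ω}     = _ ≤ω

≰∞⇒≥∞ : ∀ {x y} → ¬ x ≤∞ y → y ≤∞ x
≰∞⇒≥∞ {x}     {ω}     p = ⊥-elim (p (x ≤ω))
≰∞⇒≥∞ {fin m} {fin n} p = fin≤fin (<⇒≤ (≰⇒> (p ∘ fin≤fin)))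
≰∞⇒≥∞ {ω}     {fin n} p = _ ≤ω

≤∞-stable : ∀ {x y} → ¬ ¬ x ≤∞ y → x ≤∞ y
≤∞-stable {x} {y} = decidable-stable (x ≤∞? y)

1+n≰∞⇒≤∞n : ∀ {n x} → ¬ fin (suc n) ≤∞ x → x ≤∞ fin n
1+n≰∞⇒≤∞n {n} {fin m} p = fin≤fin (≤-pred (≰⇒> (p ∘ fin≤fin)))
1+n≰∞⇒≤∞n {n} {ω}     p = ⊥-elim (p (_ ≤ω))

≤∞n⇒1+n≰∞ : ∀ {n x} → x ≤∞ fin n → ¬ fin (suc n) ≤∞ x
≤∞n⇒1+n≰∞ p q = 1+n≰n (fin≤fin⁻¹ (≤∞-trans q p))

ω≤∞⇒≡ω : ∀ {x} → ω ≤∞ x → x ≡ ω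
ω≤∞⇒≡ω (_ ≤ω) = refl

≢ω⇒fin : ∀ {x} → x ≢ ω → ∃[ n ] x ≡ fin n
≢ω⇒fin {fin n} _ = n , refl
≢ω⇒fin {ω}     p = ⊥-elim (p refl)

-- An element of ω⁺ is the supremum of the finite elements below it; `IsAdjoint` describes residuals
-- through these.
≤∞-from-below : ∀ {x y} → (∀ n → fin n ≤∞ x → fin n ≤∞ y) → x ≤∞ y
≤∞-from-below {fin n} h = h n ≤∞-refl
≤∞-from-below {ω} {fin n} h = ⊥-elim (≤∞n⇒1+n≰∞ ≤∞-refl (h (suc n) (_ ≤ω)))
≤∞-from-below {ω} {ω} h = ω ≤ω

x⊓∞y≤∞x : ∀ x y → (x ⊓∞ y) ≤∞ x
x⊓∞y≤∞x (fin m) (fin n) = fin≤fin (m⊓n≤m m n)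
x⊓∞y≤∞x (fin m) ω       = ≤∞-refl
x⊓∞y≤∞x ω       y       = y ≤ω

x⊓∞y≤∞y : ∀ x y → (x ⊓∞ y) ≤∞ y
x⊓∞y≤∞y (fin m) (fin n) = fin≤fin (m⊓n≤n m n)
x⊓∞y≤∞y (fin m) ω       = _ ≤ω
x⊓∞y≤∞y ω       y       = ≤∞-refl

⊓∞-glb : ∀ {x y z} → z ≤∞ x → z ≤∞ y → z ≤∞ (x ⊓∞ y)
⊓∞-glb (fin≤fin p) (fin≤fin q) = fin≤fin (⊓-glb p q)
⊓∞-glb (fin≤fin p) (_ ≤ω)      = fin≤fin p
⊓∞-glb (_ ≤ω)      q           = q

x≤∞x⊔∞y : ∀ x y → x ≤∞ (x ⊔∞ y)
x≤∞x⊔∞y (fin m) (fin n) = fin≤fin (m≤m⊔n m n)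
x≤∞x⊔∞y (fin m) ω       = _ ≤ω
x≤∞x⊔∞y ω       y       = ≤∞-refl

y≤∞x⊔∞y : ∀ x y → y ≤∞ (x ⊔∞ y)
y≤∞x⊔∞y (fin m) (fin n) = fin≤fin (m≤n⊔m m n)
y≤∞x⊔∞y (fin m) ω       = ≤∞-refl
y≤∞x⊔∞y ω       y       = y ≤ω

⊔∞-sel : ∀ x y → ((x ⊔∞ y) ≡ x) ⊎ ((x ⊔∞ y) ≡ y)
⊔∞-sel (fin m) (fin n) = Sum.map (cong fin) (cong fin) (⊔-sel m n)
⊔∞-sel (fin m) ω       = inj₂ refl
⊔∞-sel ω       y       = inj₁ refl

⊔∞-lub : ∀ {x y z} → x ≤∞ z → y ≤∞ z → (x ⊔∞ y) ≤∞ z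
⊔∞-lub {x} {y} {z} p q with ⊔∞-sel x y
... | inj₁ e = subst (_≤∞ z) (sym e) p
... | inj₂ e = subst (_≤∞ z) (sym e) q

≤∞⊔∞⇒⊎ : ∀ {x y z} → z ≤∞ (x ⊔∞ y) → z ≤∞ x ⊎ z ≤∞ y
≤∞⊔∞⇒⊎ {x} {y} {z} p with ⊔∞-sel x y
... | inj₁ e = inj₁ (subst (z ≤∞_) e p)
... | inj₂ e = inj₂ (subst (z ≤∞_) e p)

pred∞-mono : ∀ {x y} → x ≤∞ y → pred∞ x ≤∞ pred∞ y
pred∞-mono {fin zero}  _                 = 0≤∞
pred∞-mono {fin (suc m)} (fin≤fin (s≤s p)) = fin≤fin p
pred∞-mono (_ ≤ω)                          = _ ≤ω

open import Data.Vec.Membership.DecPropositional _≟∞_ using (_∈?_)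

open IsWarp

-- Warps and residuals

mono-fin : ∀ {f} → IsWarp f → ∀ {m n} → m ≤ n → f (fin m) ≤∞ f (fin n)
mono-fin wf p = mono wf _ _ (fin≤fin p)

≤-at-ω : ∀ {f} → IsWarp f → ∀ x → f x ≤∞ f ω
≤-at-ω wf x = mono wf x ω (x ≤ω)

-- The constructive content of ω-sup: a finite value below f ω is reached, up to a double negation.
¬¬-reached : ∀ {f} → IsWarp f → ∀ {k} → fin k ≤∞ f ω → ¬ (∀ n → ¬ fin k ≤∞ f (fin n))
¬¬-reached wf {zero}  p none = none 0 0≤∞
¬¬-reached wf {suc k} p none =
  ≤∞n⇒1+n≰∞ (proj₂ (ω-sup wf) (fin k) λ n → 1+n≰∞⇒≤∞n (none n)) p

-- Reaching every finite `k` up to double negation suffices for join preservation, because `≤∞` is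
-- decidable and hence stable.
isWarp : ∀ {f} → (∀ {x y} → x ≤∞ y → f x ≤∞ f y) → f (fin 0) ≡ fin 0 →
         (∀ k → fin k ≤∞ f ω → ¬ (∀ n → ¬ fin k ≤∞ f (fin n))) → IsWarp f
isWarp mf zf reach = record
  { mono      = λ _ _ → mf
  ; zero-pres = zf
  ; ω-sup     = (λ n → mf (_ ≤ω)) , λ v ub → ≤∞-from-below λ k k≤fω →
      ≤∞-stable λ k≰v → reach k k≤fω λ n k≤fn → k≰v (≤∞-trans k≤fn (ub n))
  }

isWarp-∧ : ∀ {f g} → IsWarp f → IsWarp g → IsWarp (λ x → f x ⊓∞ g x)
isWarp-∧ {f} {g} wf wg = isWarp
  (λ {x} {y} p → ⊓∞-glb (≤∞-trans (x⊓∞y≤∞x _ _) (mono wf x y p)) (≤∞-trans (x⊓∞y≤∞y (f x) _) (mono wg x y p)))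
  (cong₂ _⊓∞_ (zero-pres wf) (zero-pres wg))
  λ k p none →
    ¬¬-reached wf (≤∞-trans p (x⊓∞y≤∞x _ _)) λ m k≤fm →
    ¬¬-reached wg (≤∞-trans p (x⊓∞y≤∞y (f ω) _)) λ n k≤gn →
    none (m ⊔ n) (⊓∞-glb (≤∞-trans k≤fm (mono-fin wf (m≤m⊔n m n))) (≤∞-trans k≤gn (mono-fin wg (m≤n⊔m m n))))

isWarp-∨ : ∀ {f g} → IsWarp f → IsWarp g → IsWarp (λ x → f x ⊔∞ g x)
isWarp-∨ {f} {g} wf wg = isWarp
  (λ {x} {y} p → ⊔∞-lub (≤∞-trans (mono wf x y p) (x≤∞x⊔∞y _ _)) (≤∞-trans (mono wg x y p) (y≤∞x⊔∞y (f y) _)))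
  (cong₂ _⊔∞_ (zero-pres wf) (zero-pres wg))
  λ k p none → [ (λ q → ¬¬-reached wf q λ n r → none n (≤∞-trans r (x≤∞x⊔∞y _ _)))
               , (λ q → ¬¬-reached wg q λ n r → none n (≤∞-trans r (y≤∞x⊔∞y (f (fin n)) _))) ] (≤∞⊔∞⇒⊎ p)

isWarp-∘ : ∀ {f g} → IsWarp f → IsWarp g → IsWarp (f ∘∞ g)
isWarp-∘ {f} {g} wf wg = isWarp
  (λ {x} {y} p → mono wf _ _ (mono wg x y p))
  (trans (cong f (zero-pres wg)) (zero-pres wf))
  λ k p none → go k p none (g ω) refl
  where
  -- If `g ω` is finite, `g` reaches it at a finite argument. If it is `ω`, then `f` reaches `k` at
  -- some finite `j`, and `g` reaches `j`.
  go : ∀ k → fin k ≤∞ f (g ω) → (∀ n → ¬ fin k ≤∞ f (g (fin n))) → ∀ z → g ω ≡ z → _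
  go k p none (fin j) e = ¬¬-reached wg (≤∞-reflexive (sym e)) λ n r →
    none n (≤∞-trans p (mono wf _ _ (subst (_≤∞ g (fin n)) (sym e) r)))
  go k p none ω e = ¬¬-reached wf (subst (λ z → fin k ≤∞ f z) e p) λ j k≤fj →
    ¬¬-reached wg (subst (fin j ≤∞_) (sym e) (_ ≤ω)) λ n r → none n (≤∞-trans k≤fj (mono wf _ _ r))

isWarp-id : IsWarp (λ x → x)
isWarp-id = isWarp (λ p → p) refl λ k _ none → none k ≤∞-refl

⇓-isWarp : ∀ {σ} → (∀ i → IsWarp (σ i)) → ∀ {u f} → σ ⊢ u ⇓ f → IsWarp f
⇓-isWarp w (ev-var i)  = w i
⇓-isWarp w (ev-∧ d e)  = isWarp-∧ (⇓-isWarp w d) (⇓-isWarp w e)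
⇓-isWarp w (ev-∨ d e)  = isWarp-∨ (⇓-isWarp w d) (⇓-isWarp w e)
⇓-isWarp w (ev-· d e)  = isWarp-∘ (⇓-isWarp w d) (⇓-isWarp w e)
⇓-isWarp w (ev-′ d r)  = proj₁ r
⇓-isWarp w ev-1        = isWarp-id

-- Jumping strictly after a makes step a b vanish at 0 even for a = 0.
step : ℕ → ℕ∞ → ℕ∞ → ℕ∞
step a b (fin n) with suc a ≤? n
... | yes _ = b
... | no  _ = fin 0
step a b ω = b

step-above : ∀ {a n} b → a < n → step a b (fin n) ≡ b
step-above {a} {n} b p with suc a ≤? n
... | yes _ = refl
... | no ¬p = ⊥-elim (¬p p)

step-below : ∀ {a n} b → ¬ a < n → step a b (fin n) ≡ fin 0
step-below {a} {n} b ¬p with suc a ≤? n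
... | yes p = ⊥-elim (¬p p)
... | no _  = refl

step≤ : ∀ a b x → step a b x ≤∞ b
step≤ a b (fin n) with suc a ≤? n
... | yes _ = ≤∞-refl
... | no  _ = 0≤∞
step≤ a b ω = ≤∞-refl

isWarp-step : ∀ a b → IsWarp (step a b)
isWarp-step a b = isWarp step-mono refl λ k k≤b none →
  none (suc a) (≤∞-trans k≤b (≤∞-reflexive (sym (step-above b ≤-refl))))
  where
  step-mono : ∀ {x y} → x ≤∞ y → step a b x ≤∞ step a b y
  step-mono {x} (_ ≤ω) = step≤ a b x
  step-mono {fin m} {fin n} (fin≤fin p) with suc a ≤? m
  ... | yes q = ≤∞-reflexive (sym (step-above b (≤-trans q p)))
  ... | no _  = 0≤∞

-- f′ is adjoint to f: away from 0 it is given by g x = sup {y < ω : f y < x}.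
IsAdjoint : (ℕ∞ → ℕ∞) → (ℕ∞ → ℕ∞) → Set
IsAdjoint f g = ∀ {x} → x ≢ fin 0 → ∀ y → (fin y ≤∞ g x → ¬ x ≤∞ f (fin y)) × (¬ x ≤∞ f (fin y) → fin y ≤∞ g x)

-- One direction comes from `f ∘∞ g` lying below `pred∞`, the other from maximality of `g`. At `ω`,
-- join preservation of `g` and finiteness of `f (fin y)` respectively reduce the claim to a finite
-- argument.
residual⇒adjoint : ∀ {f g} → IsWarp f → IsResidual f g → IsAdjoint f g
residual⇒adjoint {f} {g} wf (wg , fg≤p , max) {x₀} x₀≢0 y₀ = to x₀ x₀≢0 y₀ , from x₀ x₀≢0 y₀
  where
  to-suc : ∀ n y → fin y ≤∞ g (fin (suc n)) → f (fin y) ≤∞ fin n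
  to-suc n y p = ≤∞-trans (mono wf _ _ p) (fg≤p (fin (suc n)))

  to : ∀ x → x ≢ fin 0 → ∀ y → fin y ≤∞ g x → ¬ x ≤∞ f (fin y)
  to (fin zero)    x≢0 y p   = ⊥-elim (x≢0 refl)
  to (fin (suc n)) x≢0 y p   = ≤∞n⇒1+n≰∞ (to-suc n y p)
  to ω             x≢0 y p q = ¬¬-reached wg p λ
    { zero r → case0 y q (subst (fin y ≤∞_) (zero-pres wg) r)
    ; (suc n) r → absurd (≤∞-trans q (to-suc n y r)) }
    where
    absurd : ∀ {n} → ¬ ω ≤∞ fin n
    absurd ()
    case0 : ∀ y → ω ≤∞ f (fin y) → ¬ fin y ≤∞ fin 0
    case0 zero q _ = absurd (subst (ω ≤∞_) (zero-pres wf) q)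
    case0 (suc y) q (fin≤fin ())

  from-suc : ∀ n y → f (fin y) ≤∞ fin n → fin y ≤∞ g (fin (suc n))
  -- The competitor for maximality jumps from 0 to `y` at `suc n`.
  from-suc n y p = subst (_≤∞ g (fin (suc n))) (step-above (fin y) ≤-refl)
    (max (step n (fin y)) (isWarp-step n (fin y)) below (fin (suc n)))
    where
    below : (f ∘∞ step n (fin y)) ≤ₚ pred∞
    below ω = _ ≤ω
    below (fin m) with suc n ≤? m
    ... | yes q = ≤∞-trans p (pred∞-mono (fin≤fin q))
    ... | no _  = subst (_≤∞ pred∞ (fin m)) (sym (zero-pres wf)) 0≤∞

  from : ∀ x → x ≢ fin 0 → ∀ y → ¬ x ≤∞ f (fin y) → fin y ≤∞ g x
  from (fin zero)    x≢0 y p = ⊥-elim (x≢0 refl)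
  from (fin (suc n)) x≢0 y p = from-suc n y (1+n≰∞⇒≤∞n p)
  from ω             x≢0 y p with ≢ω⇒fin {f (fin y)} (p ∘ ≤∞-reflexive ∘ sym)
  ... | m , e = ≤∞-trans (from-suc m y (≤∞-reflexive e)) (≤-at-ω wg _)

adjoint⇒residual : ∀ {f g} → IsWarp f → IsWarp g → IsAdjoint f g → IsResidual f g
adjoint⇒residual {f} {g} wf wg adj = wg , below , max
  where
  suc≢0 : ∀ {n} → fin (suc n) ≢ fin 0
  suc≢0 ()

  below : (f ∘∞ g) ≤ₚ pred∞
  below ω = _ ≤ω
  below (fin zero) = ≤∞-reflexive (trans (cong f (zero-pres wg)) (zero-pres wf))
  below (fin (suc n)) = go (g (fin (suc n))) refl
    where
    at : ∀ y → fin y ≤∞ g (fin (suc n)) → f (fin y) ≤∞ fin n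
    at y p = 1+n≰∞⇒≤∞n (proj₁ (adj suc≢0 y) p)
    go : ∀ z → g (fin (suc n)) ≡ z → f (g (fin (suc n))) ≤∞ fin n
    go (fin y) e = subst (λ z → f z ≤∞ fin n) (sym e) (at y (≤∞-reflexive (sym e)))
    go ω       e = subst (λ z → f z ≤∞ fin n) (sym e)
      (proj₂ (ω-sup wf) (fin n) λ y → at y (subst (fin y ≤∞_) (sym e) (_ ≤ω)))

  max : ∀ h → IsWarp h → (f ∘∞ h) ≤ₚ pred∞ → h ≤ₚ g
  max h wh fh≤p = λ { (fin n) → max-fin n
                    ; ω → proj₂ (ω-sup wh) (g ω) λ n → ≤∞-trans (max-fin n) (≤-at-ω wg _) }
    where
    max-fin : ∀ n → h (fin n) ≤∞ g (fin n)
    max-fin zero    = subst (_≤∞ g (fin 0)) (sym (zero-pres wh)) 0≤∞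
    max-fin (suc n) = ≤∞-from-below λ y y≤h →
      proj₂ (adj suc≢0 y) (≤∞n⇒1+n≰∞ (≤∞-trans (mono wf _ _ y≤h) (fh≤p (fin (suc n)))))

-- Located warps

least : ∀ {P : ℕ → Set} → (∀ n → Dec (P n)) → ∀ n → P n → ∃[ k ] P k × (∀ j → j < k → ¬ P j)
least P? zero p = 0 , p , λ _ ()
least P? (suc n) p with P? 0
... | yes p₀ = 0 , p₀ , λ _ ()
... | no ¬p₀ with least (P? ∘ suc) n p
...   | k , pk , min = suc k , pk , λ { zero _ → ¬p₀ ; (suc j) (s≤s j<k) → min j j<k }

-- Residuals of such warps can be computed; arbitrary warps need not have this property constructively.
Located : (ℕ∞ → ℕ∞) → Set
Located f = ∀ x → Dec (∃[ n ] x ≤∞ f (fin n))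

record LocatedWarp : Set where
  constructor locatedWarp
  field
    fn      : ℕ∞ → ℕ∞
    warp    : IsWarp fn
    located : Located fn

open LocatedWarp

meet : LocatedWarp → LocatedWarp → LocatedWarp
meet (locatedWarp f wf lf) (locatedWarp g wg lg) =
  locatedWarp _ (isWarp-∧ wf wg) λ x → map′ to from (lf x ×-dec lg x)
  where
  to : ∀ {x} → (∃[ n ] x ≤∞ f (fin n)) × (∃[ n ] x ≤∞ g (fin n)) → ∃[ n ] x ≤∞ (f (fin n) ⊓∞ g (fin n))
  to ((m , p) , (n , q)) = m ⊔ n ,
    ⊓∞-glb (≤∞-trans p (mono-fin wf (m≤m⊔n m n))) (≤∞-trans q (mono-fin wg (m≤n⊔m m n)))
  from : ∀ {x} → ∃[ n ] x ≤∞ (f (fin n) ⊓∞ g (fin n)) → (∃[ n ] x ≤∞ f (fin n)) × (∃[ n ] x ≤∞ g (fin n))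
  from (n , p) = (n , ≤∞-trans p (x⊓∞y≤∞x _ _)) , (n , ≤∞-trans p (x⊓∞y≤∞y (f (fin n)) _))

join : LocatedWarp → LocatedWarp → LocatedWarp
join (locatedWarp f wf lf) (locatedWarp g wg lg) =
  locatedWarp _ (isWarp-∨ wf wg) λ x → map′ to from (lf x ⊎-dec lg x)
  where
  to : ∀ {x} → (∃[ n ] x ≤∞ f (fin n)) ⊎ (∃[ n ] x ≤∞ g (fin n)) → ∃[ n ] x ≤∞ (f (fin n) ⊔∞ g (fin n))
  to (inj₁ (n , p)) = n , ≤∞-trans p (x≤∞x⊔∞y _ _)
  to (inj₂ (n , p)) = n , ≤∞-trans p (y≤∞x⊔∞y (f (fin n)) _)
  from : ∀ {x} → ∃[ n ] x ≤∞ (f (fin n) ⊔∞ g (fin n)) → (∃[ n ] x ≤∞ f (fin n)) ⊎ (∃[ n ] x ≤∞ g (fin n))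
  from (n , p) = Sum.map (n ,_) (n ,_) (≤∞⊔∞⇒⊎ p)

least-reaching : ∀ {f} → IsWarp f → ∀ {x n} → x ≤∞ f (fin n) →
                 ∃[ k ] x ≤∞ f (fin k) × (∀ y → x ≤∞ f (fin y) → k ≤ y)
least-reaching {f} wf {x} {n} p with least (λ j → x ≤∞? f (fin j)) n p
... | k , q , min = k , q , λ y r → ≮⇒≥ λ y<k → min y y<k r

-- If `f` first reaches `x` at `k`, then `f ∘∞ g` reaches `x` exactly where `g` reaches `k`. If `f`
-- reaches `x` at no finite argument, `g` has to reach `ω`, and `x` has to lie below `f ω`.
compose : LocatedWarp → LocatedWarp → LocatedWarp
compose (locatedWarp f wf lf) (locatedWarp g wg lg) = locatedWarp (f ∘∞ g) (isWarp-∘ wf wg) loc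
  where
  loc : Located (f ∘∞ g)
  loc x with lf x
  ... | yes (_ , p) = let k , q , min = least-reaching wf p in
    map′ (λ (n , r) → n , ≤∞-trans q (mono wf _ _ r)) (λ (n , r) → n , above min (g (fin n)) r) (lg (fin k))
    where
    above : ∀ {k} → (∀ y → x ≤∞ f (fin y) → k ≤ y) → ∀ y → x ≤∞ f y → fin k ≤∞ y
    above min (fin y) r = fin≤fin (min y r)
    above min ω       r = _ ≤ω
  ... | no none with x ≤∞? f ω
  ...   | no x≰fω = no λ (n , r) → x≰fω (≤∞-trans r (≤-at-ω wf _))
  ...   | yes x≤fω = map′ (λ (n , r) → n , subst (λ y → x ≤∞ f y) (sym (ω≤∞⇒≡ω r)) x≤fω)
                          (λ (n , r) → n , infinite (g (fin n)) r) (lg ω)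
    where
    infinite : ∀ y → x ≤∞ f y → ω ≤∞ y
    infinite (fin y) r = ⊥-elim (none (y , r))
    infinite ω       r = ≤∞-refl

-- If `k` lies below `g ω`, then `f (fin k)` is some finite `j`, so `g` already reaches `k` at
-- `suc j`.
adjoint⇒isWarp : ∀ {f g} → g (fin 0) ≡ fin 0 → IsAdjoint f g → IsWarp g
adjoint⇒isWarp {f} {g} g0 adj = isWarp g-mono g0 λ k k≤gω none →
  let j , e = ≢ω⇒fin (λ e → proj₁ (adj (λ ()) k) k≤gω (≤∞-reflexive (sym e)))
  in none (suc j) (proj₂ (adj (λ ()) k) (≤∞n⇒1+n≰∞ (≤∞-reflexive e)))
  where
  g-mono : ∀ {x y} → x ≤∞ y → g x ≤∞ g y
  g-mono {x} {y} p with x ≟∞ fin 0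
  ... | yes refl = subst (_≤∞ g y) (sym g0) 0≤∞
  ... | no x≢0 = ≤∞-from-below λ k k≤gx →
    proj₂ (adj (λ { refl → x≢0 (≤∞-antisym p 0≤∞) }) k) λ y≤fk → proj₁ (adj x≢0 k) k≤gx (≤∞-trans p y≤fk)

module Residual (F : LocatedWarp) where
  private
    f  = fn F
    wf = warp F

  -- If `f` reaches `x` at some finite argument, the least such argument is a successor, since `f`
  -- fixes 0, and its predecessor is the supremum; otherwise the supremum is `ω`.
  supremum : ∀ x → x ≢ fin 0 → ∃[ z ] (∀ y → (fin y ≤∞ z → ¬ x ≤∞ f (fin y)) × (¬ x ≤∞ f (fin y) → fin y ≤∞ z))
  supremum x x≢0 with located F x
  ... | no none = ω , λ y → (λ _ r → none (y , r)) , λ _ → _ ≤ω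
  ... | yes (_ , p) with least-reaching wf p
  ...   | zero  , q , _   = ⊥-elim (x≢0 (≤∞-antisym (subst (x ≤∞_) (zero-pres wf) q) 0≤∞))
  ...   | suc k , q , min = fin k , λ y →
            (λ { (fin≤fin y≤k) r → 1+n≰n (≤-trans (min y r) y≤k) }) ,
            (λ x≰fy → fin≤fin (≮⇒≥ λ k<y → x≰fy (≤∞-trans q (mono-fin wf k<y))))

  residual : ℕ∞ → ℕ∞
  residual x with x ≟∞ fin 0
  ... | yes _  = fin 0
  ... | no x≢0 = proj₁ (supremum x x≢0)

  residual-adjoint : IsAdjoint f residual
  residual-adjoint {x} x≢0 y with x ≟∞ fin 0
  ... | yes x≡0 = ⊥-elim (x≢0 x≡0)
  ... | no x≢0′ = proj₂ (supremum x x≢0′) y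

  isWarp-residual : IsWarp residual
  isWarp-residual = adjoint⇒isWarp {f} refl residual-adjoint

  -- The residual reaches a finite `y` at a finite argument iff `f (fin y)` is finite, and `ω` iff
  -- `f ω` is finite; the successor of that value is then a suitable argument.
  residual-located : Located residual
  residual-located (fin y) = map′
    (λ fy≢ω → let j , e = ≢ω⇒fin fy≢ω in
      suc j , proj₂ (residual-adjoint (λ ()) y) (≤∞n⇒1+n≰∞ (≤∞-reflexive e)))
    (λ (n , p) fy≡ω → proj₁ (residual-adjoint {ω} (λ ()) y)
      (≤∞-trans p (≤-at-ω isWarp-residual (fin n))) (≤∞-reflexive (sym fy≡ω)))
    (¬? (f (fin y) ≟∞ ω))
  residual-located ω = map′
    (λ fω≢ω → let j , e = ≢ω⇒fin fω≢ω in
      suc j , ≤∞-from-below λ y _ → proj₂ (residual-adjoint (λ ()) y)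
        (≤∞n⇒1+n≰∞ (≤∞-trans (≤-at-ω wf _) (≤∞-reflexive e))))
    (λ { (zero , ())
       ; (suc n , p) fω≡ω → ¬¬-reached wf {suc n} (subst (fin (suc n) ≤∞_) (sym fω≡ω) (_ ≤ω)) λ y →
           proj₁ (residual-adjoint (λ ()) y) (≤∞-trans (_ ≤ω) p) })
    (¬? (f ω ≟∞ ω))

  isResidual : IsResidual f residual
  isResidual = adjoint⇒residual wf isWarp-residual residual-adjoint

  residualWarp : LocatedWarp
  residualWarp = locatedWarp residual isWarp-residual residual-located

open Residual using (residualWarp; isResidual)

identity : LocatedWarp
identity = locatedWarp (λ x → x) isWarp-id λ
  { (fin n) → yes (n , ≤∞-refl)
  ; ω → no λ { (_ , ()) } }

stepWarp : ℕ → ℕ∞ → LocatedWarp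
stepWarp a b = locatedWarp (step a b) (isWarp-step a b) λ x →
  map′ (λ p → suc a , subst (x ≤∞_) (sym (step-above b ≤-refl)) p)
       (λ (n , p) → ≤∞-trans p (step≤ a b (fin n)))
       (x ≤∞? b)

evaluate : (τ : ℕ → LocatedWarp) → (u : Term) → Σ LocatedWarp λ F → (fn ∘ τ) ⊢ u ⇓ fn F
evaluate τ (var i) = τ i , ev-var i
evaluate τ (s ∧ t) = let F , d = evaluate τ s ; G , e = evaluate τ t in meet F G , ev-∧ d e
evaluate τ (s ∨ t) = let F , d = evaluate τ s ; G , e = evaluate τ t in join F G , ev-∨ d e
evaluate τ (s · t) = let F , d = evaluate τ s ; G , e = evaluate τ t in compose F G , ev-· d e
evaluate τ (s ′)   = let F , d = evaluate τ s in residualWarp F , ev-′ d (isResidual F)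
evaluate τ one     = identity , ev-1

-- Compression

-- Counting the distinct elements of xs below n is strictly increasing on xs, and takes
-- the successor of an element of xs to a successor.
rank : ∀ {k} → Vec ℕ∞ k → ℕ → ℕ
rank xs zero = 0
rank xs (suc n) with fin n ∈? xs
... | yes _ = suc (rank xs n)
... | no  _ = rank xs n

rank-∈ : ∀ {k} (xs : Vec ℕ∞ k) {n} → fin n ∈ xs → rank xs (suc n) ≡ suc (rank xs n)
rank-∈ xs {n} p with fin n ∈? xs
... | yes _ = refl
... | no ¬p = ⊥-elim (¬p p)

rank-∉ : ∀ {k} (xs : Vec ℕ∞ k) {n} → ¬ fin n ∈ xs → rank xs (suc n) ≡ rank xs n
rank-∉ xs {n} ¬p with fin n ∈? xs
... | yes p = ⊥-elim (¬p p)
... | no _  = refl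

rank-≤-suc : ∀ {k} (xs : Vec ℕ∞ k) n → rank xs n ≤ rank xs (suc n)
rank-≤-suc xs n with fin n ∈? xs
... | yes _ = n≤1+n _
... | no _  = ≤-refl

rank-mono : ∀ {k} (xs : Vec ℕ∞ k) {m n} → m ≤ n → rank xs m ≤ rank xs n
rank-mono xs {n = zero} z≤n = ≤-refl
rank-mono xs {m} {suc n} p with m ≤? n
... | yes q = ≤-trans (rank-mono xs q) (rank-≤-suc xs n)
... | no ¬q = ≤-reflexive (cong (rank xs) (≤-antisym p (≰⇒> ¬q)))

rank-∷-∉ : ∀ {k} {xs : Vec ℕ∞ k} {x} n → (∀ m → m < n → fin m ≢ x) → rank (x ∷ xs) n ≤ rank xs n
rank-∷-∉ zero _ = z≤n
rank-∷-∉ {xs = xs} {x} (suc n) x∉ = by (fin n ∈? xs)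
  where
  IH : rank (x ∷ xs) n ≤ rank xs n
  IH = rank-∷-∉ n λ m q → x∉ m (m<n⇒m<1+n q)
  by : Dec (fin n ∈ xs) → rank (x ∷ xs) (suc n) ≤ rank xs (suc n)
  by (yes p) = subst₂ _≤_ (sym (rank-∈ (x ∷ xs) (there p))) (sym (rank-∈ xs p)) (s≤s IH)
  by (no ¬p) = subst₂ _≤_ (sym (rank-∉ (x ∷ xs) λ { (here e) → x∉ n ≤-refl e ; (there p) → ¬p p })) (sym (rank-∉ xs ¬p)) IH

-- `x` is counted at most once: if it is met at `n`, no smaller number equals it, and `rank-∷-∉`
-- applies below `n`.
rank-∷ : ∀ {k} (xs : Vec ℕ∞ k) x n → rank (x ∷ xs) n ≤ suc (rank xs n)
rank-∷ xs x zero = z≤n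
rank-∷ xs x (suc n) = by (fin n ≟∞ x) (fin n ∈? xs)
  where
  by : Dec (fin n ≡ x) → Dec (fin n ∈ xs) → rank (x ∷ xs) (suc n) ≤ suc (rank xs (suc n))
  by (yes refl) _ = ≤-trans (≤-reflexive (rank-∈ (fin n ∷ xs) (here refl)))
    (s≤s (≤-trans (rank-∷-∉ n λ { m m<n refl → <-irrefl refl m<n }) (rank-≤-suc xs n)))
  by (no n≢x) (yes p) = subst₂ _≤_ (sym (rank-∈ (x ∷ xs) (there p))) (cong suc (sym (rank-∈ xs p))) (s≤s (rank-∷ xs x n))
  by (no n≢x) (no ¬p) = subst₂ _≤_ (sym (rank-∉ (x ∷ xs) λ { (here e) → n≢x e ; (there p) → ¬p p }))
    (cong suc (sym (rank-∉ xs ¬p))) (rank-∷ xs x n)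

rank-≤-length : ∀ {k} (xs : Vec ℕ∞ k) n → rank xs n ≤ k
rank-≤-length [] zero = z≤n
rank-≤-length [] (suc n) = rank-≤-length [] n
rank-≤-length (x ∷ xs) n = ≤-trans (rank-∷ xs x n) (s≤s (rank-≤-length xs n))

suc∞ : ℕ∞ → ℕ∞
suc∞ (fin n) = fin (suc n)
suc∞ ω       = ω

Finitary : (ℕ∞ → ℕ∞) → Set
Finitary f = ∀ n → f (fin n) ≢ ω

-- Lengths of the sample vectors, computed from the term alone so that the space of codes is fixed
-- before any assignment is given.
mutual
  size : Term → ℕ
  size (var i) = 1
  size (s ∧ t) = size s + size t
  size (s ∨ t) = size s + size t
  size (s · t) = size t + size s
  size (s ′)   = 2 + (size s + (size s + tailSize s))
  size one     = 0

  tailSize : Term → ℕ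
  tailSize (var i) = 0
  tailSize (s ∧ t) = tailSize s + tailSize t
  tailSize (s ∨ t) = tailSize s + tailSize t
  tailSize (s · t) = tailSize s + (tailSize t + (size s + (size t + size s)))
  tailSize (s ′)   = size s
  tailSize one     = 0

-- The points that determine the value of u at v; tailSamples are those needed to decide
-- whether u takes finite arguments to finite values.
mutual
  samples : ∀ {σ u f} → σ ⊢ u ⇓ f → ℕ∞ → Vec ℕ∞ (size u)
  samples (ev-var i) v = v ∷ []
  samples (ev-∧ d e) v = samples d v ++ samples e v
  samples (ev-∨ d e) v = samples d v ++ samples e v
  samples (ev-· {g = g} d e) v = samples e v ++ samples d (g v)
  samples (ev-′ {f = f} {g} d r) v =
    g v ∷ f (g v) ∷ (samples d (g v) ++ (samples d (suc∞ (g v)) ++ tailSamples d))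
  samples ev-1 v = []

  tailSamples : ∀ {σ u f} → σ ⊢ u ⇓ f → Vec ℕ∞ (tailSize u)
  tailSamples (ev-var i) = []
  tailSamples (ev-∧ d e) = tailSamples d ++ tailSamples e
  tailSamples (ev-∨ d e) = tailSamples d ++ tailSamples e
  tailSamples (ev-· {g = g} d e) =
    tailSamples d ++ (tailSamples e ++ (samples d ω ++ (samples e ω ++ samples d (g ω))))
  tailSamples (ev-′ d r) = samples d ω
  tailSamples ev-1 = []

maxVar : Term → ℕ
maxVar (var i) = suc i
maxVar (s ∧ t) = maxVar s ⊔ maxVar t
maxVar (s ∨ t) = maxVar s ⊔ maxVar t
maxVar (s · t) = maxVar s ⊔ maxVar t
maxVar (s ′)   = maxVar s
maxVar one     = 0

module Compression {L} (V : Vec ℕ∞ L) (0∈V : fin 0 ∈ V) where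

  compress : ℕ∞ → ℕ∞
  compress (fin n) = fin (rank V n)
  compress ω       = ω

  compress-mono : ∀ {x y} → x ≤∞ y → compress x ≤∞ compress y
  compress-mono (fin≤fin p) = fin≤fin (rank-mono V p)
  compress-mono (_ ≤ω)      = _ ≤ω

  -- A number `m` of `V` with `m < n` is counted in the rank of `n` but not in its own.
  compress-reflects : ∀ {x y} → x ∈ V → compress y ≤∞ compress x → y ≤∞ x
  compress-reflects {fin m} {fin n} m∈V (fin≤fin p) = fin≤fin (≮⇒≥ λ m<n →
    1+n≰n (≤-trans (≤-reflexive (sym (rank-∈ V m∈V))) (≤-trans (rank-mono V m<n) p)))
  compress-reflects {ω} _ _ = _ ≤ω

  compress-injective : ∀ {x y} → x ∈ V → y ∈ V → compress x ≡ compress y → x ≡ y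
  compress-injective x∈V y∈V e =
    ≤∞-antisym (compress-reflects y∈V (≤∞-reflexive e)) (compress-reflects x∈V (≤∞-reflexive (sym e)))

  -- The reason for putting 0 into `V`: adjointness describes residuals only away from 0, so nonzero
  -- points must stay nonzero.
  compress≡0 : ∀ {x} → compress x ≡ fin 0 → x ≡ fin 0
  compress≡0 e = ≤∞-antisym (compress-reflects 0∈V (≤∞-reflexive e)) 0≤∞

  compress≡ω : ∀ {x} → compress x ≡ ω → x ≡ ω
  compress≡ω {ω} _ = refl

  compress-⊓ : ∀ x y → compress (x ⊓∞ y) ≡ (compress x ⊓∞ compress y)
  compress-⊓ (fin m) (fin n) = cong fin (mono-≤-distrib-⊓ (rank-mono V) m n)
  compress-⊓ (fin m) ω       = refl
  compress-⊓ ω       y       = refl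

  compress-⊔ : ∀ x y → compress (x ⊔∞ y) ≡ (compress x ⊔∞ compress y)
  compress-⊔ (fin m) (fin n) = cong fin (mono-≤-distrib-⊔ (rank-mono V) m n)
  compress-⊔ (fin m) ω       = refl
  compress-⊔ ω       y       = refl

  -- A finite `w = g v` is characterized by `f w < v ≤ f (w + 1)`. The strict inequality survives
  -- because `f w ∈ V`, the weak one by monotonicity, and `w ∈ V` makes the image of `w + 1` the
  -- successor of that of `w`. If `w = ω`, all finite arguments of `f` have values below `v`: a
  -- finite `v` then exceeds `f ω ∈ V`, and for `v = ω` the warp `f` is finitary.
  residual-transfer : ∀ {f f* g g*} → IsWarp f → IsWarp f* → IsAdjoint f g → IsAdjoint f* g* →
    ∀ v → v ≢ fin 0 → ∀ w → w ≡ g v → w ∈ V → f w ∈ V →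
    f* (compress w) ≡ compress (f w) → f* (compress (suc∞ w)) ≡ compress (f (suc∞ w)) →
    (Finitary f → Finitary f*) → g* (compress v) ≡ compress w
  residual-transfer {f} {f*} {g} {g*} wf wf* adj adj* v v≢0 (fin w) w≡gv w∈V fw∈V at-w at-sw _ =
    ≤∞-antisym
      (1+n≰∞⇒≤∞n λ p → proj₁ (adj* cv≢0 _) p
        (subst (λ n → compress v ≤∞ f* (fin n)) (rank-∈ V w∈V)
          (subst (compress v ≤∞_) (sym at-sw) (compress-mono v≤fsw))))
      (proj₂ (adj* cv≢0 _) λ p →
        proj₁ (adj v≢0 w) (≤∞-reflexive w≡gv) (compress-reflects fw∈V (subst (compress v ≤∞_) at-w p)))
    where
    cv≢0 : compress v ≢ fin 0
    cv≢0 e = v≢0 (compress≡0 e)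
    v≤fsw : v ≤∞ f (fin (suc w))
    v≤fsw = ≤∞-stable λ v≰ → ≤∞n⇒1+n≰∞ (≤∞-reflexive (sym w≡gv)) (proj₂ (adj v≢0 (suc w)) v≰)
  residual-transfer {f} {f*} {g} {g*} wf wf* adj adj* v v≢0 ω ω≡gv _ fω∈V at-ω _ finitary =
    ω≤∞⇒≡ω (≤∞-from-below λ y _ → proj₂ (adj* (λ e → v≢0 (compress≡0 e)) y) (below v v≢0 f<v y))
    where
    f<v : ∀ y → ¬ v ≤∞ f (fin y)
    f<v y = proj₁ (adj v≢0 y) (subst (fin y ≤∞_) ω≡gv (_ ≤ω))
    below : ∀ v → v ≢ fin 0 → (∀ y → ¬ v ≤∞ f (fin y)) → ∀ y → ¬ compress v ≤∞ f* (fin y)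
    below ω _ f<v y p = finitary (λ n e → f<v n (≤∞-reflexive (sym e))) y (ω≤∞⇒≡ω p)
    below (fin zero) v≢0 f<v y p = v≢0 refl
    below (fin (suc n)) _ f<v y p = ≤∞n⇒1+n≰∞ (proj₂ (ω-sup wf) (fin n) (1+n≰∞⇒≤∞n ∘ f<v))
      (compress-reflects fω∈V (subst (fin (rank V (suc n)) ≤∞_) at-ω (≤∞-trans p (≤-at-ω wf* _))))

  -- If `g*` sends `suc n` to `ω`, then `f*` never reaches `suc n`, so `f* ω` and with it `f ω` are
  -- finite, and `g` is `ω` at the successor of `f ω`.
  residual-finitary : ∀ {f f* g g*} → IsWarp f → IsWarp f* → IsAdjoint f g → IsAdjoint f* g* →
    g* (fin 0) ≡ fin 0 → f* ω ≡ compress (f ω) → Finitary g → Finitary g*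
  residual-finitary wf wf* adj adj* g*0 at-ω fin-g zero e with trans (sym g*0) e
  ... | ()
  residual-finitary {f} {f*} wf wf* adj adj* g*0 at-ω fin-g (suc n) e =
    let k , fω≡k = ≢ω⇒fin fω≢ω in
    fin-g (suc k) (ω≤∞⇒≡ω (≤∞-from-below λ y _ →
      proj₂ (adj (λ ()) y) (≤∞n⇒1+n≰∞ (≤∞-trans (≤-at-ω wf _) (≤∞-reflexive fω≡k)))))
    where
    f*ω≤n : f* ω ≤∞ fin n
    f*ω≤n = proj₂ (ω-sup wf*) (fin n) λ y →
      1+n≰∞⇒≤∞n (proj₁ (adj* (λ ()) y) (subst (fin y ≤∞_) (sym e) (_ ≤ω)))
    fω≢ω : f ω ≢ ω
    fω≢ω fω≡ω with subst (_≤∞ fin n) (trans at-ω (cong compress fω≡ω)) f*ω≤n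
    ... | ()

  -- If `f* (g* n) = ω`, then `f ω = ω`; so `g` is finitary, as `f ∘∞ g` is, and hence `g*` too. If
  -- `g ω = ω`, values of `g` exceed every finite number, so `f` and then `f*` are finitary. If
  -- `g ω` is finite, `g` attains it at a finite argument, where `f ∘∞ g` would be `ω`.
  composite-finitary : ∀ {f f* g g*} → IsWarp f → IsWarp g → IsWarp f* → IsWarp g* →
    f* ω ≡ compress (f ω) → g* ω ≡ compress (g ω) → f* (compress (g ω)) ≡ compress (f (g ω)) →
    (Finitary f → Finitary f*) → (Finitary g → Finitary g*) → Finitary (f ∘∞ g) → Finitary (f* ∘∞ g*)
  composite-finitary {f} {f*} {g} {g*} wf wg wf* wg* f-at-ω g-at-ω fg-at-ω f-fin g-fin fg-fin n e =
    go (g ω) refl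
    where
    ω≤f*g*n : ω ≤∞ f* (g* (fin n))
    ω≤f*g*n = ≤∞-reflexive (sym e)
    fω≡ω : f ω ≡ ω
    fω≡ω = compress≡ω (trans (sym f-at-ω) (ω≤∞⇒≡ω (≤∞-trans ω≤f*g*n (≤-at-ω wf* _))))
    g*-finitary : Finitary g*
    g*-finitary = g-fin λ k gk≡ω → fg-fin k (trans (cong f gk≡ω) fω≡ω)
    go : ∀ z → ¬ g ω ≡ z
    go ω gω≡ω =
      let m , g*n≡m = ≢ω⇒fin (g*-finitary n) in
      f-fin (λ k fk≡ω → ¬¬-reached wg (subst (fin k ≤∞_) (sym gω≡ω) (_ ≤ω)) λ j k≤gj →
              fg-fin j (ω≤∞⇒≡ω (≤∞-trans (≤∞-reflexive (sym fk≡ω)) (mono wf _ _ k≤gj))))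
        m (trans (cong f* (sym g*n≡m)) e)
    go (fin k) gω≡k = ¬¬-reached wg (≤∞-reflexive (sym gω≡k)) λ j k≤gj →
      fg-fin j (ω≤∞⇒≡ω (≤∞-trans (≤∞-reflexive (sym fgω≡ω)) (mono wf _ _ (subst (_≤∞ g (fin j)) (sym gω≡k) k≤gj))))
      where
      fgω≡ω : f (g ω) ≡ ω
      fgω≡ω = compress≡ω (trans (sym fg-at-ω) (trans (cong f* (sym g-at-ω))
        (ω≤∞⇒≡ω (≤∞-trans ω≤f*g*n (mono wf* _ _ (≤-at-ω wg* _))))))

  record Agrees (f f* : ℕ∞ → ℕ∞) : Set where
    field
      values   : ∀ {v} → v ∈ V → f* (compress v) ≡ compress (f v)
      finitary : Finitary f → Finitary f*

  module Transfer {σ τ : ℕ → ℕ∞ → ℕ∞} (wσ : ∀ i → IsWarp (σ i)) (wτ : ∀ i → IsWarp (τ i))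
                  {K} (agrees : ∀ {i} → i < K → Agrees (σ i) (τ i)) where

    mutual
      -- The recursion is mutual because a residual with value `ω` calls for `finitary` of its
      -- argument, while `finitary` of composites and residuals rests on values at `ω`.
      transfer : ∀ {u f f*} (d : σ ⊢ u ⇓ f) → τ ⊢ u ⇓ f* → maxVar u ≤ K →
                 ∀ {v} → All (_∈ V) (samples d v) → f* (compress v) ≡ compress (f v)
      transfer (ev-var i) (ev-var .i) i<K (v∈V ∷ []) = Agrees.values (agrees i<K) v∈V
      transfer {s ∧ t} (ev-∧ {f = f} {g} d e) (ev-∧ d* e*) b {v} a =
        let ad , ae = ++⁻ (samples d v) a in
        trans (cong₂ _⊓∞_ (transfer d d* (m⊔n≤o⇒m≤o _ _ b) ad) (transfer e e* (m⊔n≤o⇒n≤o (maxVar s) _ b) ae))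
              (sym (compress-⊓ (f v) (g v)))
      transfer {s ∨ t} (ev-∨ {f = f} {g} d e) (ev-∨ d* e*) b {v} a =
        let ad , ae = ++⁻ (samples d v) a in
        trans (cong₂ _⊔∞_ (transfer d d* (m⊔n≤o⇒m≤o _ _ b) ad) (transfer e e* (m⊔n≤o⇒n≤o (maxVar s) _ b) ae))
              (sym (compress-⊔ (f v) (g v)))
      transfer {s · t} (ev-· d e) (ev-· {f = f*} d* e*) b {v} a =
        let ae , ad = ++⁻ (samples e v) a in
        trans (cong f* (transfer e e* (m⊔n≤o⇒n≤o (maxVar s) _ b) ae)) (transfer d d* (m⊔n≤o⇒m≤o _ _ b) ad)
      transfer (ev-′ {g = g} d r) (ev-′ d* r*) b {v} (w∈V ∷ fw∈V ∷ a) with v ≟∞ fin 0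
      -- Adjointness says nothing at 0, but both residuals vanish there.
      ... | yes refl = trans (zero-pres (proj₁ r*)) (sym (cong compress (zero-pres (proj₁ r))))
      ... | no v≢0 =
        let a₁ , a₂₃ = ++⁻ (samples d (g v)) a
            a₂ , a₃  = ++⁻ (samples d (suc∞ (g v))) a₂₃
            wf  = ⇓-isWarp wσ d
            wf* = ⇓-isWarp wτ d*
        in residual-transfer wf wf* (residual⇒adjoint wf r) (residual⇒adjoint wf* r*) v v≢0 (g v) refl w∈V fw∈V
             (transfer d d* b a₁) (transfer d d* b a₂) (finitary d d* b a₃)
      transfer ev-1 ev-1 _ _ = refl

      finitary : ∀ {u f f*} (d : σ ⊢ u ⇓ f) → τ ⊢ u ⇓ f* → maxVar u ≤ K →
                 All (_∈ V) (tailSamples d) → Finitary f → Finitary f*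
      finitary (ev-var i) (ev-var .i) i<K _ = Agrees.finitary (agrees i<K)
      finitary {s ∧ t} (ev-∧ {f = f} {g} d e) (ev-∧ {f = f*} {g*} d* e*) b a fin-fg n eq =
        let ad , ae = ++⁻ (tailSamples d) a in
        -- This avoids deciding which factor is finitary: if `f k = ω`, then `g` and hence `g*` are
        -- finitary, against `g* n = ω`.
        finitary d d* (m⊔n≤o⇒m≤o _ _ b) ad
          (λ k fk≡ω → finitary e e* (m⊔n≤o⇒n≤o (maxVar s) _ b) ae
            (λ l gl≡ω → fin-fg (k ⊔ l) (ω≤∞⇒≡ω (⊓∞-glb
              (≤∞-trans (≤∞-reflexive (sym fk≡ω)) (mono-fin (⇓-isWarp wσ d) (m≤m⊔n k l)))
              (≤∞-trans (≤∞-reflexive (sym gl≡ω)) (mono-fin (⇓-isWarp wσ e) (m≤n⊔m k l))))))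
            n (ω≤∞⇒≡ω (≤∞-trans (≤∞-reflexive (sym eq)) (x⊓∞y≤∞y (f* (fin n)) _))))
          n (ω≤∞⇒≡ω (≤∞-trans (≤∞-reflexive (sym eq)) (x⊓∞y≤∞x (f* (fin n)) _)))
      finitary {s ∨ t} (ev-∨ {f = f} {g} d e) (ev-∨ {f = f*} {g*} d* e*) b a fin-fg n eq =
        let ad , ae = ++⁻ (tailSamples d) a in
        [ (λ p → finitary d d* (m⊔n≤o⇒m≤o _ _ b) ad
            (λ k fk≡ω → fin-fg k (ω≤∞⇒≡ω (≤∞-trans (≤∞-reflexive (sym fk≡ω)) (x≤∞x⊔∞y _ _))))
            n (ω≤∞⇒≡ω p))
        , (λ p → finitary e e* (m⊔n≤o⇒n≤o (maxVar s) _ b) ae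
            (λ k gk≡ω → fin-fg k (ω≤∞⇒≡ω (≤∞-trans (≤∞-reflexive (sym gk≡ω)) (y≤∞x⊔∞y (f (fin k)) _))))
            n (ω≤∞⇒≡ω p))
        ] (≤∞⊔∞⇒⊎ (≤∞-reflexive (sym eq)))
      finitary {s · t} (ev-· {f = f} {g} d e) (ev-· {f = f*} {g*} d* e*) b a fin-fg =
        let ad , a₁ = ++⁻ (tailSamples d) a
            ae , a₂ = ++⁻ (tailSamples e) a₁
            sd , a₃ = ++⁻ (samples d ω) a₂
            se , sde = ++⁻ (samples e ω) a₃
            bd = m⊔n≤o⇒m≤o _ _ b
            be = m⊔n≤o⇒n≤o (maxVar s) _ b
        in composite-finitary (⇓-isWarp wσ d) (⇓-isWarp wσ e) (⇓-isWarp wτ d*) (⇓-isWarp wτ e*)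
             (transfer d d* bd sd) (transfer e e* be se) (transfer d d* bd sde)
             (finitary d d* bd ad) (finitary e e* be ae) fin-fg
      finitary (ev-′ d r) (ev-′ d* r*) b a =
        let wf  = ⇓-isWarp wσ d
            wf* = ⇓-isWarp wτ d*
        in residual-finitary wf wf* (residual⇒adjoint wf r) (residual⇒adjoint wf* r*)
             (zero-pres (proj₁ r*)) (transfer d d* b a)
      finitary ev-1 ev-1 _ _ fin-id = fin-id

-- Finite codes for the compressed warps

joins : ∀ {k} → Vec LocatedWarp k → LocatedWarp → LocatedWarp
joins []       T = T
joins (F ∷ Fs) T = join F (joins Fs T)

joins-lub : ∀ {k} {Fs : Vec LocatedWarp k} {T x z} →
            All (λ F → fn F x ≤∞ z) Fs → fn T x ≤∞ z → fn (joins Fs T) x ≤∞ z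
joins-lub []       q = q
joins-lub (p ∷ ps) q = ⊔∞-lub p (joins-lub ps q)

≤-joins : ∀ {k} {Fs : Vec LocatedWarp k} {F} T x → F ∈ Fs → fn F x ≤∞ fn (joins Fs T) x
≤-joins {F = F} T x (here refl) = x≤∞x⊔∞y (fn F x) _
≤-joins {Fs = G ∷ _} T x (there p) = ≤∞-trans (≤-joins T x p) (y≤∞x⊔∞y (fn G x) _)

tail-≤-joins : ∀ {k} (Fs : Vec LocatedWarp k) T x → fn T x ≤∞ fn (joins Fs T) x
tail-≤-joins []       T x = ≤∞-refl
tail-≤-joins (F ∷ Fs) T x = ≤∞-trans (tail-≤-joins Fs T x) (y≤∞x⊔∞y (fn F x) _)

joins-finitary : ∀ {k} {Fs : Vec LocatedWarp k} {T} →
                 All (λ F → Finitary (fn F)) Fs → Finitary (fn T) → Finitary (fn (joins Fs T))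
joins-finitary [] q = q
joins-finitary {Fs = F ∷ Fs} (p ∷ ps) q n e with ⊔∞-sel (fn F (fin n)) (fn (joins Fs _) (fin n))
... | inj₁ e′ = p n (trans (sym e′) e)
... | inj₂ e′ = joins-finitary ps q n (trans (sym e′) e)

module Code (L : ℕ) where

  Value Warp : Set
  Value = Maybe (Fin (suc L))
  Warp  = Vec (Fin (suc L) × Value) L × Maybe Value

  value : Value → ℕ∞
  value (just k) = fin (toℕ k)
  value nothing  = ω

  entry : Fin (suc L) × Value → LocatedWarp
  entry (a , b) = stepWarp (toℕ a) (value b)

  -- The tail only affects arguments above L: it is constant, or the identity for the code nothing.
  tail : Maybe Value → LocatedWarp
  tail (just b) = stepWarp L (value b)
  tail nothing  = meet (stepWarp L ω) identity

  decode : Warp → LocatedWarp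
  decode (es , t) = joins (map entry es) (tail t)

  tail-below : ∀ t {n} → n ≤ L → fn (tail t) (fin n) ≡ fin 0
  tail-below (just b) n≤L = step-below (value b) (≤⇒≯ n≤L)
  tail-below nothing {n} n≤L = cong (_⊓∞ fin n) (step-below ω (≤⇒≯ n≤L))

module Encoding {L} (V : Vec ℕ∞ L) (0∈V : fin 0 ∈ V) where
  open Code L
  open Compression V 0∈V

  -- The predecessor offsets the strict jump of `step`, which now occurs at `rank V n`. Truncation
  -- matters only at `n = 0`, where a warp vanishes anyway.
  encodeRank : ℕ → Fin (suc L)
  encodeRank n = fromℕ< (s≤s (≤-trans (pred[n]≤n {rank V n}) (rank-≤-length V n)))

  encodeValue : ℕ∞ → Value
  encodeValue (fin n) = just (fromℕ< (s≤s (rank-≤-length V n)))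
  encodeValue ω       = nothing

  value-encodeValue : ∀ x → value (encodeValue x) ≡ compress x
  value-encodeValue (fin n) = cong fin (toℕ-fromℕ< _)
  value-encodeValue ω       = refl

  -- ω ∈ V is irrelevant for the entries, so it is mapped to the zero step.
  encodeEntry : (ℕ∞ → ℕ∞) → ℕ∞ → Fin (suc L) × Value
  encodeEntry f (fin v) = encodeRank v , encodeValue (f (fin v))
  encodeEntry f ω       = fzero , just fzero

  -- A constant tail `ω` would destroy the finitary property, hence the identity for finitary `f`
  -- with `f ω = ω`.
  encodeTail : ∀ f → Dec (Finitary f) → Maybe Value
  encodeTail f (yes _) with f ω
  ... | ω     = nothing
  ... | fin k = just (encodeValue (fin k))
  encodeTail f (no _) = just (encodeValue (f ω))

  encode : ∀ f → Dec (Finitary f) → Warp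
  encode f f? = map (encodeEntry f) V , encodeTail f f?

  -- At the image of a finite point of `V` its own entry gives the value, the other entries stay
  -- below by monotonicity, and the tail vanishes. At `ω` the tail gives the value.
  encode-agrees : ∀ {f} → IsWarp f → (f? : Dec (Finitary f)) → Agrees f (fn (decode (encode f f?)))
  encode-agrees {f} wf f? = record
    { values   = values
    ; finitary = λ fin-f →
        joins-finitary {Fs = Fs} {T} (all-entries (entry-finitary fin-f)) (tail-finitary fin-f f?)
    }
    where
    T = tail (encodeTail f f?)
    F = entry ∘ encodeEntry f
    Fs = map entry (map (encodeEntry f) V)

    entry-fin : ∀ y x → fn (F (fin y)) x ≡ step (pred (rank V y)) (compress (f (fin y))) x
    entry-fin y x = cong₂ (λ a b → step a b x) (toℕ-fromℕ< _) (value-encodeValue (f (fin y)))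

    step-0 : ∀ a x → step a (fin 0) x ≡ fin 0
    step-0 a x = ≤∞-antisym (step≤ a (fin 0) x) 0≤∞

    all-entries : ∀ {P : LocatedWarp → Set} → (∀ y → P (F y)) → All P Fs
    all-entries p = map⁺ (map⁺ (All.universal p V))

    entry-≤ω : ∀ y → fn (F y) ω ≤∞ compress (f ω)
    entry-≤ω (fin y) = subst (_≤∞ compress (f ω)) (sym (entry-fin y ω)) (compress-mono (≤-at-ω wf _))
    entry-≤ω ω = 0≤∞

    entry-≤ : ∀ {v} → fin v ∈ V → ∀ y → fn (F y) (fin (rank V v)) ≤∞ compress (f (fin v))
    entry-≤ {v} v∈V (fin y) = subst (_≤∞ compress (f (fin v))) (sym (entry-fin y _)) bound
      where
      bound : step (pred (rank V y)) (compress (f (fin y))) (fin (rank V v)) ≤∞ compress (f (fin v))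
      bound with suc (pred (rank V y)) ≤? rank V v
      -- An active step means that the rank of `y` is at most that of `v`; as `v ∈ V`, this gives
      -- `y ≤ v`.
      ... | yes p = compress-mono (mono wf _ _ (compress-reflects v∈V (fin≤fin (≤-trans (suc-pred-≤ _) p))))
        where
        suc-pred-≤ : ∀ n → n ≤ suc (pred n)
        suc-pred-≤ zero = z≤n
        suc-pred-≤ (suc n) = ≤-refl
      ... | no _  = 0≤∞
    entry-≤ {v} v∈V ω = subst (_≤∞ compress (f (fin v))) (sym (step-0 0 (fin (rank V v)))) 0≤∞

    entry-≥ : ∀ v → compress (f (fin v)) ≤∞ fn (F (fin v)) (fin (rank V v))
    entry-≥ v = subst (compress (f (fin v)) ≤∞_) (sym (entry-fin v _)) (go (rank V v) refl)
      where
      go : ∀ r → rank V v ≡ r → compress (f (fin v)) ≤∞ step (pred r) (compress (f (fin v))) (fin r)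
      go (suc r) e = ≤∞-reflexive (sym (step-above _ ≤-refl))
      go zero    e = ≤∞-reflexive (cong compress (trans (cong f (compress≡0 (cong fin e))) (zero-pres wf)))

    tail-ω : ∀ f? → fn (tail (encodeTail f f?)) ω ≡ compress (f ω)
    tail-ω (yes _) with f ω
    ... | ω     = refl
    ... | fin k = value-encodeValue (fin k)
    tail-ω (no _) = value-encodeValue (f ω)

    values : ∀ {v} → v ∈ V → fn (joins Fs T) (compress v) ≡ compress (f v)
    values {fin v} v∈V = ≤∞-antisym
      (joins-lub {Fs = Fs} {T} (all-entries (entry-≤ v∈V))
        (subst (_≤∞ compress (f (fin v))) (sym (tail-below (encodeTail f f?) (rank-≤-length V v))) 0≤∞))
      (≤∞-trans (entry-≥ v) (≤-joins {Fs = Fs} T _ (∈-map⁺ entry (∈-map⁺ (encodeEntry f) v∈V))))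
    values {ω} _ = ≤∞-antisym
      (joins-lub {Fs = Fs} {T} (all-entries entry-≤ω) (≤∞-reflexive (tail-ω f?)))
      (≤∞-trans (≤∞-reflexive (sym (tail-ω f?))) (tail-≤-joins Fs T ω))

    entry-finitary : Finitary f → ∀ y → Finitary (fn (F y))
    entry-finitary fin-f (fin y) n e = fin-f y (compress≡ω (ω≤∞⇒≡ω
      (subst (_≤∞ compress (f (fin y))) (trans (sym (entry-fin y (fin n))) e) (step≤ (pred (rank V y)) _ (fin n)))))
    entry-finitary fin-f ω n e with trans (sym (step-0 0 (fin n))) e
    ... | ()

    tail-finitary : Finitary f → ∀ f? → Finitary (fn (tail (encodeTail f f?)))
    tail-finitary fin-f (no ¬fin-f) = ⊥-elim (¬fin-f fin-f)
    tail-finitary fin-f (yes _) n e with f ω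
    ... | ω with subst (_≤∞ fin n) e (x⊓∞y≤∞y (step L ω (fin n)) (fin n))
    ...   | ()
    tail-finitary fin-f (yes _) n e | fin k
      with subst (_≤∞ value (encodeValue (fin k))) e (step≤ L (value (encodeValue (fin k))) (fin n))
    ...   | ()

-- Search for a small counterexample

Searchable : Set → Set₁
Searchable A = ∀ {P : A → Set} → (∀ a → Dec (P a)) → Dec (∃ P)

search-Maybe : ∀ {A} → Searchable A → Searchable (Maybe A)
search-Maybe search P? = map′
  (λ { (inj₁ p) → nothing , p ; (inj₂ (a , p)) → just a , p })
  (λ { (nothing , p) → inj₁ p ; (just a , p) → inj₂ (a , p) })
  (P? nothing ⊎-dec search (P? ∘ just))

search-× : ∀ {A B} → Searchable A → Searchable B → Searchable (A × B)
search-× searchA searchB P? = map′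
  (λ (a , b , p) → (a , b) , p)
  (λ ((a , b) , p) → a , b , p)
  (searchA λ a → searchB λ b → P? (a , b))

search-Vec : ∀ {A} → Searchable A → ∀ n → Searchable (Vec A n)
search-Vec search zero P? = map′ ([] ,_) (λ { ([] , p) → p }) (P? [])
search-Vec search (suc n) P? = map′
  (λ (a , as , p) → a ∷ as , p)
  (λ { (a ∷ as , p) → a , as , p })
  (search λ a → search-Vec search n λ as → P? (a ∷ as))

-- Double-negation shift over a finite index set, for using finitely many instances of excluded
-- middle at once.
¬¬-choice : ∀ n {P : Fin n → Set} → (∀ i → ¬ ¬ P i) → ¬ ¬ (∀ i → P i)
¬¬-choice zero    h k = k λ ()
¬¬-choice (suc n) h k = h fzero λ p → ¬¬-choice n (h ∘ fsuc) λ ps → k λ { fzero → p ; (fsuc i) → ps i }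

self-∈ : ∀ {A : Set} {k} (xs : Vec A k) → All (_∈ xs) xs
self-∈ []       = []
self-∈ (x ∷ xs) = here refl ∷ All.map there (self-∈ xs)

module _ (s t : Term) where
  private
    K = maxVar s ⊔ maxVar t
    -- The 3 counts 0 and the values of `s` and `t` at the point where they differ.
    L = 3 + (size s + size t)

  open Code L

  assignment : Vec Warp K → ℕ → LocatedWarp
  assignment cs i with suc i ≤? K
  ... | yes i<K = decode (lookup cs (fromℕ< i<K))
  -- A default: variables from `K` on do not occur in `s` or `t`.
  ... | no _    = identity

  Counterexample : Vec Warp K × Value → Set
  Counterexample (cs , x) =
    fn (proj₁ (evaluate (assignment cs) s)) (value x) ≢ fn (proj₁ (evaluate (assignment cs) t)) (value x)

  counterexample? : Dec (∃ Counterexample)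
  counterexample? = search-× (search-Vec search-Warp K) search-Value λ (cs , x) → ¬? (_ ≟∞ _)
    where
    search-Value : Searchable Value
    search-Value = search-Maybe any?
    search-Warp : Searchable Warp
    search-Warp = search-× (search-Vec (search-× any? search-Value) L) (search-Maybe search-Value)

  counterexample⇒invalid : ∃ Counterexample → ¬ (⊨W s ≈ t)
  counterexample⇒invalid ((cs , x) , s≢t) valid =
    let τ = assignment cs
        F , d = evaluate τ s
        G , e = evaluate τ t
    in s≢t (valid (fn ∘ τ) (warp ∘ τ) (fn F) (fn G) d e (value x))

  -- The double negation allows the case distinction on whether each variable below `K` is finitary,
  -- on which its code depends.
  small-counterexample : ∀ {σ f g} → (∀ i → IsWarp (σ i)) → σ ⊢ s ⇓ f → σ ⊢ t ⇓ g →
                         ∀ x → f x ≢ g x → ¬ ¬ ∃ Counterexample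
  small-counterexample {σ} {f} {g} wσ d e x fx≢gx none =
    ¬¬-choice K {λ i → Dec (Finitary (σ (toℕ i)))} (λ i → ¬¬-excluded-middle)
      λ finitary? → none (counterexample finitary?)
    where
    V : Vec ℕ∞ L
    -- With `f x` and `g x` in `V`, their images remain distinct.
    V = fin 0 ∷ f x ∷ g x ∷ (samples d x ++ samples e x)

    0∈V : fin 0 ∈ V
    0∈V = here refl

    samples∈V : All (_∈ V) (samples d x) × All (_∈ V) (samples e x)
    samples∈V = ++⁻ (samples d x) (All.map (there ∘ there ∘ there) (self-∈ (samples d x ++ samples e x)))

    open Compression V 0∈V
    open Encoding V 0∈V

    counterexample : (∀ i → Dec (Finitary (σ (toℕ i)))) → ∃ Counterexample
    counterexample finitary? = (cs , encodeValue x) , differ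
      where
      code : Fin K → Warp
      code i = encode (σ (toℕ i)) (finitary? i)

      cs : Vec Warp K
      cs = tabulate code

      τ : ℕ → LocatedWarp
      τ = assignment cs

      agrees : ∀ {i} → i < K → Agrees (σ i) (fn (τ i))
      agrees {i} i<K with suc i ≤? K
      ... | no i≮K = ⊥-elim (i≮K i<K)
      ... | yes p  =
        subst (λ c → Agrees (σ i) (fn (decode c))) (sym (lookup∘tabulate code (fromℕ< p)))
          (subst (λ j → Agrees (σ j) (fn (decode (code (fromℕ< p))))) (toℕ-fromℕ< p)
            (encode-agrees (wσ _) (finitary? (fromℕ< p))))

      open Transfer wσ (warp ∘ τ) agrees

      differ : Counterexample (cs , encodeValue x)
      differ eq =
        let F , d* = evaluate τ s
            G , e* = evaluate τ t
            ad , ae = samples∈V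
            eq′ = subst (λ v → fn F v ≡ fn G v) (value-encodeValue x) eq
        in fx≢gx (compress-injective (there (here refl)) (there (there (here refl)))
             (trans (sym (transfer d d* (m≤m⊔n _ _) ad)) (trans eq′ (transfer e e* (m≤n⊔m (maxVar s) _) ae))))

theorem3p12 : (s t : Term) → Dec (⊨W s ≈ t)
theorem3p12 s t = map′
  (λ ¬c σ wσ f g d e x → decidable-stable (f x ≟∞ g x) λ fx≢gx → small-counterexample s t wσ d e x fx≢gx ¬c)
  (λ valid c → counterexample⇒invalid s t c valid)
  (¬? (counterexample? s t))
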